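{- For each positive integer $n$, player ONE has a winning strategy in the game $\mathsf{GCDS}(\mathcal{G}_n,\mathsf{A}_n)$ if, and only if, $n$ is odd.
   Context: **The graphs $\mathcal{G}_n$ and sets $\mathsf{A}_n$.** $\mathcal{G}_1$ is the triangle with vertex set $\{1,2,3\}$ and edges $\{1,2\},\{1,3\},\{2,3\}$. Given $\mathcal{G}_n=(V_n,E_n)$ with $V_n=\{1,2,\dots,2n+1\}$, the graph $\mathcal{G}_{n+1}=(V_{n+1},E_{n+1})$ has $V_{n+1}=V_n\cup\{2n+2,2n+3\}$ and $E_{n+1}=E_n\cup\{\{2n+1,2n+2\},\{2n+1,2n+3\},\{2n+2,2n+3\}\}$. For each $n$, $\mathsf{A}_n=\{2\}\cup\{k\in V_n : k \bmod 4=0\}$. **The graph transformation gcds.** Let $\mathcal{G}=(V,E)$ be a graph and $\{x,y\}\in E$. The master list of $\{x,y\}$ has two columns: the first consists of all neighbors of $x$ in $\mathcal{G}$ except $y$, the second of all neighbors of $y$ in $\mathcal{G}$ except $x$. The graph $\mathbf{gcds}(\mathcal{G},\{x,y\})=(V,E')$ is defined as follows. Both $x$ and $y$ are isolated in it. For $p\ne q$ in $V\setminus\{x,y\}$: (a) if $p$ or $q$ is not in the master list, then $\{p,q\}\in E'$ iff $\{p,q\}\in E$; (b) if both are in the master list, then: (b.1) if no column contains both $p$ and $q$, then $\{p,q\}\in E'$ iff $\{p,q\}\notin E$; (b.2) if some column contains both and the total number of occurrences of $p$ and $q$ in the master list (both columns together) is even, then $\{p,q\}\in E'$ iff $\{p,q\}\in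 E$; (b.3) if some column contains both and that total number is odd, then $\{p,q\}\in E'$ iff $\{p,q\}\notin E$. **The modification $\mathbf{gcds}_2$.** For a finite graph $\mathcal{G}=(V,E)$ and $\{a,b\}\in E$, compute $(V,E')=\mathbf{gcds}(\mathcal{G},\{a,b\})$; then delete $a$ and $b$, and also delete every vertex $v$ in the master list of $\{a,b\}$ that is isolated in $(V,E')$, unless $v$ is the only vertex in the master list. With $V'$ the set of remaining vertices, $\mathbf{gcds}_2(\mathcal{G},\{a,b\})=(V',E')$. **The game.** For a finite graph $\mathcal{G}=(V,E)$ and $\mathsf{A}\subseteq V$, the game $\mathsf{GCDS}(\mathcal{G},\mathsf{A})$ starts with current graph $\mathcal{G}$. Players ONE and TWO alternate, ONE moving first; a move consists of choosing an edge $\{a,b\}$ of the current graph $\mathcal{C}$ and replacing $\mathcal{C}$ by $\mathbf{gcds}_2(\mathcal{C},\{a,b\})$. The game ends when the current graph has no edges. If the vertex set of the final graph is nonempty and is a subset of $\mathsf{A}$, then ONE wins; otherwise TWO wins. -}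

module Defs where

open import Data.Bool.Base using (Bool; true; false; not; _∧_; _∨_; if_then_else_)
open import Data.Bool.ListAction using (all)
open import Data.Bool.Properties using (∨-comm; ∧-comm; T-≡; T?)
open import Data.Empty using (⊥-elim)
open import Data.List.Base using (List; filterᵇ; applyUpTo)
open import Data.List.Membership.Propositional using (_∈_)
open import Data.List.Membership.Propositional.Properties using (∈-filter⁺; ∈-applyUpTo⁺)
open import Data.List.Relation.Unary.Any using (here; there)
open import Data.Nat.Base using (ℕ; suc; _+_; _*_; _≤_; _<_; s≤s; z≤n; NonZero; _≡ᵇ_)
open import Data.Nat.DivMod using (_%_)
open import Data.Nat.Properties using (≡ᵇ⇒≡; +-comm; +-assoc; *-suc; ≤-refl; ≤-reflexive; ≤-trans; m≤n+m; +-monoˡ-≤; +-monoʳ-≤; *-monoʳ-≤; n≤1+n; +-cancelˡ-≡)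
open import Data.Product.Base using (Σ; ∃-syntax; _×_; _,_; proj₁; proj₂)
open import Data.Sum.Base using (_⊎_; inj₁; inj₂; [_,_])
open import Function.Base using (_∘_)
open import Function.Bundles using (mk⇔; module Equivalence)
open import Level using (0ℓ)
open import Relation.Binary.Definitions using (DecidableEquality)
open import Relation.Binary.PropositionalEquality using (_≡_; _≢_; refl; sym; trans; cong; cong₂)
open import Relation.Nullary.Decidable using (does; does-⇔; dec-true)
open import Relation.Nullary.Negation using (¬_)
open import Relation.Unary using (Pred)

-- Finite simple graphs with vertices taken from X.  Only membership in the
-- list V matters, not the order or the multiplicity of its entries.
record Graph (X : Set) : Set where
  field
    V        : List X
    adj      : X → X → Bool
    adj-sym  : ∀ p q → adj p q ≡ adj q p
    adj-irr  : ∀ p → adj p p ≡ false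
    adj-in-V : ∀ p q → adj p q ≡ true → p ∈ V

open Graph public

-- An edge {x , y}, given by an ordering of its two endpoints.
Edge : {X : Set} → Graph X → Set
Edge {X} G = Σ X λ x → Σ X λ y → adj G x y ≡ true

isolated : {X : Set} → Graph X → X → Bool
isolated G v = all (λ w → not (adj G v w)) (V G)

bit : Bool → ℕ
bit b = if b then 1 else 0

even : ℕ → Bool
even n = (n % 2) ≡ᵇ 0

module Transformation {X : Set} (_≟_ : DecidableEquality X) where

  infix 4 _==_

  _==_ : X → X → Bool
  p == q = does (p ≟ q)

  module _ (G : Graph X) (e : Edge G) where

    private
      x = proj₁ e
      y = proj₁ (proj₂ e)

    column₁ column₂ inMasterList : X → Bool
    column₁ p = adj G x p ∧ not (p == y)
    column₂ p = adj G y p ∧ not (p == x)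
    inMasterList p = column₁ p ∨ column₂ p

    someColumnContains : X → X → Bool
    someColumnContains p q = (column₁ p ∧ column₁ q) ∨ (column₂ p ∧ column₂ q)

    occurrences : X → ℕ
    occurrences p = bit (column₁ p) + bit (column₂ p)

    isEndpoint : X → Bool
    isEndpoint p = (p == x) ∨ (p == y)

    gcdsAdj : X → X → Bool
    gcdsAdj p q =
      if isEndpoint p ∨ isEndpoint q then false else
      if p == q then false else
      if not (inMasterList p ∧ inMasterList q) then adj G p q else
      if not (someColumnContains p q) then not (adj G p q) else
      if even (occurrences p + occurrences q) then adj G p q else
      not (adj G p q)

    private
      ==-sym : ∀ p q → (p == q) ≡ (q == p)
      ==-sym p q = does-⇔ (mk⇔ sym sym) (p ≟ q) (q ≟ p)

      gcdsAdj-sym : ∀ p q → gcdsAdj p q ≡ gcdsAdj q p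
      gcdsAdj-sym p q
        rewrite ∨-comm (isEndpoint p) (isEndpoint q)
              | ==-sym p q
              | ∧-comm (inMasterList p) (inMasterList q)
              | ∧-comm (column₁ p) (column₁ q)
              | ∧-comm (column₂ p) (column₂ q)
              | +-comm (occurrences p) (occurrences q)
              | adj-sym G p q
              = refl

      gcdsAdj-irr : ∀ p → gcdsAdj p p ≡ false
      gcdsAdj-irr p with isEndpoint p ∨ isEndpoint p
      ... | true = refl
      ... | false rewrite dec-true (p ≟ p) refl = refl

      ∧-true₁ : ∀ {b c} → b ∧ c ≡ true → b ≡ true
      ∧-true₁ {true} _ = refl

      ∨-true : ∀ b {c} → b ∨ c ≡ true → (b ≡ true) ⊎ (c ≡ true)
      ∨-true true  _ = inj₁ refl
      ∨-true false h = inj₂ h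

      inMasterList-in-V : ∀ p → inMasterList p ≡ true → p ∈ V G
      inMasterList-in-V p h with ∨-true (column₁ p) h
      ... | inj₁ h₁ = adj-in-V G p x (trans (adj-sym G p x) (∧-true₁ h₁))
      ... | inj₂ h₂ = adj-in-V G p y (trans (adj-sym G p y) (∧-true₁ h₂))

      gcdsAdj-in-V : ∀ p q → gcdsAdj p q ≡ true → p ∈ V G
      gcdsAdj-in-V p q h with isEndpoint p ∨ isEndpoint q
      gcdsAdj-in-V p q () | true
      ... | false with p == q
      gcdsAdj-in-V p q () | false | true
      ... | false with inMasterList p ∧ inMasterList q in eq
      ... | false = adj-in-V G p q h
      ... | true  = inMasterList-in-V p (∧-true₁ eq)

    gcds : Graph X
    gcds = record
      { V        = V G
      ; adj      = gcdsAdj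
      ; adj-sym  = gcdsAdj-sym
      ; adj-irr  = gcdsAdj-irr
      ; adj-in-V = gcdsAdj-in-V
      }

    onlyInMasterList : X → Bool
    onlyInMasterList v =
      inMasterList v ∧ all (λ w → not (inMasterList w) ∨ (w == v)) (V G)

    deleted : X → Bool
    deleted v =
      isEndpoint v ∨ (inMasterList v ∧ isolated gcds v ∧ not (onlyInMasterList v))

    -- The deleted vertices are all isolated in gcds, so the edge set is unchanged.
    gcds₂ : Graph X
    gcds₂ = record
      { V        = filterᵇ (not ∘ deleted) (V G)
      ; adj      = adj gcds
      ; adj-sym  = adj-sym gcds
      ; adj-irr  = adj-irr gcds
      ; adj-in-V = in-V′
      }
      where
      endpoint-isolated : ∀ p q → gcdsAdj p q ≡ true → isEndpoint p ≡ false
      endpoint-isolated p q h with isEndpoint p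
      ... | false = refl
      endpoint-isolated p q () | true

      all-not-false : ∀ (f : X → Bool) {w} → f w ≡ true → ∀ {ws} → w ∈ ws →
                      all (λ u → not (f u)) ws ≡ false
      all-not-false f fw (here refl) rewrite fw = refl
      all-not-false f fw (there {x = u} i) with f u
      ... | true  = refl
      ... | false = all-not-false f fw i

      not-isolated : ∀ p q → gcdsAdj p q ≡ true → isolated gcds p ≡ false
      not-isolated p q h = all-not-false (gcdsAdj p) h
        (gcdsAdj-in-V q p (trans (gcdsAdj-sym q p) h))

      kept : ∀ {a} b {c d} → a ≡ false → c ≡ false → not (a ∨ (b ∧ c ∧ d)) ≡ true
      kept true  refl refl = refl
      kept false refl refl = refl

      not-deleted : ∀ p q → gcdsAdj p q ≡ true → not (deleted p) ≡ true
      not-deleted p q h =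
        kept (inMasterList p) (endpoint-isolated p q h) (not-isolated p q h)

      in-V′ : ∀ p q → gcdsAdj p q ≡ true → p ∈ filterᵇ (not ∘ deleted) (V G)
      in-V′ p q h = ∈-filter⁺ (T? ∘ not ∘ deleted) (gcdsAdj-in-V p q h)
        (Equivalence.from T-≡ (not-deleted p q h))

NoEdges : {X : Set} → Graph X → Set
NoEdges G = ∀ p q → adj G p q ≡ false

data Player : Set where
  ONE TWO : Player

opponent : Player → Player
opponent ONE = TWO
opponent TWO = ONE

module GCDS {X : Set} (_≟_ : DecidableEquality X) (G : Graph X) (A : Pred X 0ℓ) where

  open Transformation _≟_ using (gcds₂)

  -- Play P C: the sequences of moves leading from the initial graph G to the
  -- current graph C, with player P to move next.
  infixl 5 _▷_

  data Play : Player → Graph X → Set where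
    start : Play ONE G
    _▷_   : ∀ {P C} → Play P C → (e : Edge C) → Play (opponent P) (gcds₂ C e)

  -- A strategy may depend on the whole history of the play.
  StrategyONE : Set
  StrategyONE = ∀ {C} → Play ONE C → .(¬ NoEdges C) → Edge C

  data Follows (σ : StrategyONE) : ∀ {P C} → Play P C → Set where
    start  : Follows σ start
    byONE  : ∀ {C} {π : Play ONE C} → Follows σ π → .(ne : ¬ NoEdges C) →
             Follows σ (π ▷ σ π ne)
    byTWO  : ∀ {C} {π : Play TWO C} → Follows σ π → (e : Edge C) →
             Follows σ (π ▷ e)

  FinalWinONE : Graph X → Set
  FinalWinONE C = (∃[ v ] v ∈ V C) × (∀ v → v ∈ V C → A v)

  -- Each move deletes at least the endpoints of the chosen edge, so no play goes
  -- on forever and it is enough to look at the finished ones.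
  Winning : StrategyONE → Set
  Winning σ = ∀ {P C} (π : Play P C) → Follows σ π → NoEdges C → FinalWinONE C

  ONEHasWinningStrategy : Set
  ONEHasWinningStrategy = Σ StrategyONE Winning

vertices : ℕ → List ℕ
vertices n = applyUpTo suc (2 * n + 1)

edge : ℕ → ℕ → ℕ → ℕ → Bool
edge a b p q = ((p ≡ᵇ a) ∧ (q ≡ᵇ b)) ∨ ((p ≡ᵇ b) ∧ (q ≡ᵇ a))

triangle : ℕ → ℕ → ℕ → ℕ → ℕ → Bool
triangle a b c p q = edge a b p q ∨ edge a c p q ∨ edge b c p q

𝒢-adj : (n : ℕ) .{{_ : NonZero n}} → ℕ → ℕ → Bool
𝒢-adj 1 p q = triangle 1 2 3 p q
𝒢-adj (suc n@(suc _)) p q =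
  𝒢-adj n p q ∨ triangle (2 * n + 1) (2 * n + 2) (2 * n + 3) p q

private
  ∨-true′ : ∀ b {c} → b ∨ c ≡ true → (b ≡ true) ⊎ (c ≡ true)
  ∨-true′ true  _ = inj₁ refl
  ∨-true′ false h = inj₂ h

  edge-sym : ∀ a b p q → edge a b p q ≡ edge a b q p
  edge-sym a b p q
    rewrite ∧-comm (p ≡ᵇ a) (q ≡ᵇ b) | ∧-comm (p ≡ᵇ b) (q ≡ᵇ a)
    = ∨-comm ((q ≡ᵇ b) ∧ (p ≡ᵇ a)) ((q ≡ᵇ a) ∧ (p ≡ᵇ b))

  triangle-sym : ∀ a b c p q → triangle a b c p q ≡ triangle a b c q p
  triangle-sym a b c p q =
    cong₂ _∨_ (edge-sym a b p q) (cong₂ _∨_ (edge-sym a c p q) (edge-sym b c p q))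

  ≡ᵇ-true : ∀ {m n} → (m ≡ᵇ n) ≡ true → m ≡ n
  ≡ᵇ-true {m} {n} h = ≡ᵇ⇒≡ m n (Equivalence.from T-≡ h)

  edge-irr : ∀ a b p → a ≢ b → edge a b p p ≡ false
  edge-irr a b p a≢b with p ≡ᵇ a in p=a | p ≡ᵇ b in p=b
  ... | true  | true  = ⊥-elim (a≢b (trans (sym (≡ᵇ-true {p} p=a)) (≡ᵇ-true {p} p=b)))
  ... | true  | false = refl
  ... | false | true  = refl
  ... | false | false = refl

  triangle-irr : ∀ a b c p → a ≢ b → a ≢ c → b ≢ c → triangle a b c p p ≡ false
  triangle-irr a b c p a≢b a≢c b≢c
    rewrite edge-irr a b p a≢b | edge-irr a c p a≢c | edge-irr b c p b≢c = refl

  edge-end : ∀ a b p q → edge a b p q ≡ true → (p ≡ a) ⊎ (p ≡ b)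
  edge-end a b p q h with p ≡ᵇ a in p=a | p ≡ᵇ b in p=b
  ... | true  | _    = inj₁ (≡ᵇ-true {p} p=a)
  ... | false | true = inj₂ (≡ᵇ-true {p} p=b)
  edge-end a b p q () | false | false

  InRange : ℕ → ℕ → Set
  InRange n k = (0 < k) × (k ≤ 2 * n + 1)

  triangle-range : ∀ n a b c p q → InRange n a → InRange n b → InRange n c →
                   triangle a b c p q ≡ true → InRange n p
  triangle-range n a b c p q ra rb rc h with ∨-true′ (edge a b p q) h
  ... | inj₁ h₁ = [ (λ { refl → ra }) , (λ { refl → rb }) ] (edge-end a b p q h₁)
  ... | inj₂ h₂ with ∨-true′ (edge a c p q) h₂
  ... | inj₁ h₁ = [ (λ { refl → ra }) , (λ { refl → rc }) ] (edge-end a c p q h₁)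
  ... | inj₂ h₃ = [ (λ { refl → rb }) , (λ { refl → rc }) ] (edge-end b c p q h₃)

  shift : ∀ n j → j ≤ 3 → 0 < j → InRange (suc n) (2 * n + j)
  shift n j j≤3 0<j =
    ≤-trans 0<j (m≤n+m j (2 * n)) ,
    ≤-trans (+-monoʳ-≤ (2 * n) j≤3) (≤-reflexive (eq n))
    where
    eq : ∀ n → 2 * n + 3 ≡ 2 * suc n + 1
    eq n = trans (sym (+-assoc (2 * n) 2 1))
                 (cong (_+ 1) (trans (+-comm (2 * n) 2) (sym (*-suc 2 n))))

  distinct : ∀ m {i j} → i ≢ j → m + i ≢ m + j
  distinct m i≢j = i≢j ∘ +-cancelˡ-≡ m _ _

  𝒢-sym : ∀ n .{{_ : NonZero n}} p q → 𝒢-adj n p q ≡ 𝒢-adj n q p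
  𝒢-sym 1 p q = triangle-sym 1 2 3 p q
  𝒢-sym (suc n@(suc _)) p q =
    cong₂ _∨_ (𝒢-sym n p q) (triangle-sym (2 * n + 1) (2 * n + 2) (2 * n + 3) p q)

  𝒢-irr : ∀ n .{{_ : NonZero n}} p → 𝒢-adj n p p ≡ false
  𝒢-irr 1 p = triangle-irr 1 2 3 p (λ ()) (λ ()) (λ ())
  𝒢-irr (suc n@(suc _)) p = cong₂ _∨_ (𝒢-irr n p)
    (triangle-irr (2 * n + 1) (2 * n + 2) (2 * n + 3) p
      (distinct (2 * n) (λ ())) (distinct (2 * n) (λ ())) (distinct (2 * n) (λ ())))

  𝒢-range : ∀ n .{{_ : NonZero n}} p q → 𝒢-adj n p q ≡ true → InRange n p
  𝒢-range 1 p q = triangle-range 1 1 2 3 p q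
    (s≤s z≤n , s≤s z≤n) (s≤s z≤n , s≤s (s≤s z≤n)) (s≤s z≤n , ≤-refl)
  𝒢-range (suc n@(suc _)) p q h =
    [ (λ h₁ → weaken (𝒢-range n p q h₁))
    , triangle-range (suc n) (2 * n + 1) (2 * n + 2) (2 * n + 3) p q
        (shift n 1 (s≤s z≤n) (s≤s z≤n)) (shift n 2 (s≤s (s≤s z≤n)) (s≤s z≤n))
        (shift n 3 ≤-refl (s≤s z≤n))
    ] (∨-true′ (𝒢-adj n p q) h)
    where
    weaken : InRange n p → InRange (suc n) p
    weaken (0<p , p≤) = 0<p , ≤-trans p≤ (+-monoˡ-≤ 1 (*-monoʳ-≤ 2 (n≤1+n n)))

  range-in-vertices : ∀ n k → InRange n k → k ∈ vertices n
  range-in-vertices n (suc k) (_ , k<) = ∈-applyUpTo⁺ suc k<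

𝒢 : (n : ℕ) .{{_ : NonZero n}} → Graph ℕ
𝒢 n = record
  { V        = vertices n
  ; adj      = 𝒢-adj n
  ; adj-sym  = 𝒢-sym n
  ; adj-irr  = 𝒢-irr n
  ; adj-in-V = λ p q h → range-in-vertices n p (𝒢-range n p q h)
  }

𝖠 : ℕ → Pred ℕ 0ℓ
𝖠 n k = (k ≡ 2) ⊎ (k ∈ vertices n × k % 4 ≡ 0)

{-# OPTIONS --safe #-}
module Submission where

-- A move is a Schur complement over the field with two elements,
--   adj′ p q = adj p q + adj x p · adj y q + adj y p · adj x q,
-- so two successive moves depend only on the set of four vertices removed.
-- Number the vertices of 𝒢 n from 0, so that the i-th triangle (from 0) is
-- {2i, 2i+1, 2i+2}.  Whatever edge of a triangle is played in a copy of 𝒢 (2 + h),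
-- the opponent can remove the third corner together with a vertex of a neighbouring
-- triangle so that the rest is a copy of 𝒢 h; hence the opponent of the player to
-- move in a copy of 𝒢 (2 * m) steers the game down to one vertex.  For even n,
-- TWO keeps labels of odd vertices at all even positions, so that the last vertex is
-- odd.  For odd n, ONE first removes the last triangle, swaps the two interchangeable
-- vertices 1 and 2 to get 𝖠 at the positions 0, 3, 7, 11, ..., and keeps it there.

open import Axiom.UniquenessOfIdentityProofs using (module Decidable⇒UIP)
open import Defs
open import Data.Bool.Base using (Bool; true; false; not; _∧_; _∨_; _xor_; T)
open import Data.Bool.ListAction using (all)
open import Data.Bool.Properties using (T?; T-≡; ∧-zeroʳ; ∨-identityʳ)
import Data.Bool.Properties as Bool
open import Data.Empty using (⊥-elim; ⊥-elim-irr)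
open import Data.Fin.Base using (Fin; zero; suc; toℕ; fromℕ<)
import Data.Fin.Properties as Fin
open import Data.List.Base using ([]; _∷_)
open import Data.List.Membership.Propositional using (_∈_; find; lose)
open import Data.List.Membership.Propositional.Properties
  using (∈-filter⁺; ∈-filter⁻; ∈-applyUpTo⁺; ∈-applyUpTo⁻)
open import Data.List.Relation.Unary.Any using (any?; here; there)
open import Data.Maybe.Base using (Maybe; just; nothing)
open import Data.Nat.Base
  using (ℕ; zero; suc; _+_; _*_; _≤_; _<_; s≤s; z≤n; NonZero; _≡ᵇ_)
open import Data.Nat.Divisibility using (divides; m%n≡0⇒n∣m)
open import Data.Nat.DivMod using (_%_; _/_; m%n<n; m≡m%n+[m/n]*n; m*n%n≡0)
open import Data.Nat.Properties
open import Data.Product.Base using (_×_; _,_; proj₁; proj₂; ∃-syntax; Σ-syntax)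
open import Data.Sum.Base as Sum using (_⊎_; inj₁; inj₂; [_,_])
open import Data.Vec.Base using (Vec; []; _∷_; lookup; tabulate)
open import Data.Vec.Properties using (lookup∘tabulate)
open import Function.Base using (_∘_; id; case_of_)
open import Function.Bundles using (_⇔_; mk⇔; module Equivalence)
open import Level using (0ℓ)
open import Relation.Binary.Definitions using (DecidableEquality)
open import Relation.Binary.PropositionalEquality
  using (_≡_; _≢_; refl; sym; trans; cong; cong₂; subst)
open import Relation.Nullary.Decidable
  using (Dec; yes; no; dec-true; dec-false; toWitness; _×-dec_; _⊎-dec_)
open import Relation.Nullary.Negation using (¬_)
open import Relation.Unary using (Pred)

-- Moves as Schur complements.

schur : {X : Set} → (X → X → Bool) → X → X → X → X → Bool
schur g a b p q = (g a p ∧ g b q) xor ((g b p ∧ g a q) xor g p q)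

module GraphLemmas {X : Set} (_≟ˣ_ : DecidableEquality X) where

  open Transformation _≟ˣ_

  module _ (G : Graph X) (e : Edge G) where

    private
      x = proj₁ e
      y = proj₁ (proj₂ e)

    -- The block on {x, y} has zero diagonal and ones off it, so it is its own inverse. The rows of
    -- x and y cancel because x and y are adjacent and have no loops. Elsewhere the correction is
    -- the determinant of the incidence vectors (`adj G x p`, `adj G y p`) and (`adj G x q`,
    -- `adj G y q`): it is 1 exactly when both are nonzero and they differ, that is, with no common
    -- column or with three occurrences in all.
    gcdsAdj≡schur : ∀ p q → gcdsAdj G e p q ≡ schur (adj G) x y p q
    gcdsAdj≡schur p q with p ≟ˣ x
    ... | yes refl rewrite adj-irr G x | adj-sym G y x | proj₂ (proj₂ e) with adj G x q
    ...   | true  = refl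
    ...   | false = refl
    gcdsAdj≡schur p q | no p≢x with p ≟ˣ y
    ... | yes refl rewrite adj-irr G y | proj₂ (proj₂ e) with adj G y q
    ...   | true  = refl
    ...   | false = refl
    gcdsAdj≡schur p q | no p≢x | no p≢y with q ≟ˣ x
    ... | yes refl rewrite adj-irr G x | adj-sym G y x | proj₂ (proj₂ e) | adj-sym G p x
      with adj G x p | adj G y p
    ...   | true  | true  = refl
    ...   | true  | false = refl
    ...   | false | true  = refl
    ...   | false | false = refl
    gcdsAdj≡schur p q | no p≢x | no p≢y | no q≢x with q ≟ˣ y
    ... | yes refl rewrite adj-irr G y | proj₂ (proj₂ e) | adj-sym G p y with adj G x p | adj G y p
    ...   | true  | true  = refl
    ...   | true  | false = refl
    ...   | false | true  = refl
    ...   | false | false = refl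
    gcdsAdj≡schur p q | no p≢x | no p≢y | no q≢x | no q≢y with p ≟ˣ q
    ... | yes refl rewrite adj-irr G p with adj G x p | adj G y p
    ...   | true  | true  = refl
    ...   | true  | false = refl
    ...   | false | true  = refl
    ...   | false | false = refl
    gcdsAdj≡schur p q | no p≢x | no p≢y | no q≢x | no q≢y | no p≢q
      with adj G x p | adj G y p | adj G x q | adj G y q | adj G p q
    ... | false | false | _     | _     | _     = refl
    ... | true  | false | false | false | _     = refl
    ... | true  | true  | false | false | _     = refl
    ... | false | true  | false | false | _     = refl
    ... | true  | false | true  | false | _     = refl
    ... | true  | false | false | true  | _     = refl
    ... | true  | false | true  | true  | _     = refl
    ... | false | true  | true  | false | _     = refl
    ... | false | true  | false | true  | _     = refl
    ... | false | true  | true  | true  | _     = refl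
    ... | true  | true  | true  | false | _     = refl
    ... | true  | true  | false | true  | _     = refl
    ... | true  | true  | true  | true  | true  = refl
    ... | true  | true  | true  | true  | false = refl

    private
      remains : ∀ {v} → v ∈ V G → deleted G e v ≡ false → v ∈ V (gcds₂ G e)
      remains i d = ∈-filter⁺ (T? ∘ not ∘ deleted G e) i (Equivalence.from T-≡ (cong not d))

      undeleted : ∀ {v} → v ∈ V (gcds₂ G e) → v ∈ V G × T (not (deleted G e v))
      undeleted = ∈-filter⁻ (T? ∘ not ∘ deleted G e)

    ∈-gcds₂⁻ : ∀ {v} → v ∈ V (gcds₂ G e) → v ∈ V G × v ≢ x × v ≢ y
    ∈-gcds₂⁻ {v} i with undeleted i
    ... | v∈ , t with v ≟ˣ x | v ≟ˣ y
    ...   | no v≢x | no v≢y = v∈ , v≢x , v≢y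

    private
      all-true : ∀ (f : X → Bool) ws → (∀ {w} → w ∈ ws → f w ≡ true) → all f ws ≡ true
      all-true f []       h = refl
      all-true f (w ∷ ws) h rewrite h (here refl) = all-true f ws (h ∘ there)

    -- This is the clause "unless v is the only vertex in the master list".
    third-vertex-stays : ∀ {v} → adj G v x ≡ true → adj G v y ≡ true →
      (∀ {w} → w ∈ V G → w ≡ x ⊎ w ≡ y ⊎ w ≡ v) → v ∈ V (gcds₂ G e)
    third-vertex-stays {v} vx vy only = remains (adj-in-V G v x vx) kept
      where
      differs : ∀ {w} → adj G v w ≡ true → v ≢ w
      differs vw refl with () ← trans (sym vw) (adj-irr G v)

      outside : ∀ {w} → w ∈ V G → not (inMasterList G e w) ∨ (w == v) ≡ true
      outside {w} i with only i
      ... | inj₁ refl rewrite adj-irr G x | dec-true (x ≟ˣ x) refl with adj G y x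
      ...   | true  = refl
      ...   | false = refl
      outside i | inj₂ (inj₁ refl) rewrite adj-irr G y | dec-true (y ≟ˣ y) refl with adj G x y
      ...   | true  = refl
      ...   | false = refl
      outside i | inj₂ (inj₂ refl) rewrite dec-true (v ≟ˣ v) refl with inMasterList G e v
      ...   | true  = refl
      ...   | false = refl

      spared : ∀ {a} b c {d} → a ≡ false → d ≡ true → a ∨ (b ∧ c ∧ not (b ∧ d)) ≡ false
      spared true  true  refl refl = refl
      spared true  false refl refl = refl
      spared false _     refl refl = refl

      kept : deleted G e v ≡ false
      kept = spared (inMasterList G e v) (isolated (gcds G e) v)
        (cong₂ _∨_ (dec-false (v ≟ˣ x) (differs vx)) (dec-false (v ≟ˣ y) (differs vy)))
        (all-true (λ w → not (inMasterList G e w) ∨ (w == v)) (V G) outside)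

-- The infinite chain of triangles.

-- The adjacency of the infinite chain of triangles {2i, 2i+1, 2i+2}.
chain : ℕ → ℕ → Bool
chain 0 0 = false
chain 0 1 = true
chain 0 2 = true
chain 0 (suc (suc (suc _))) = false
chain 1 0 = true
chain 1 1 = false
chain 1 2 = true
chain 1 (suc (suc (suc _))) = false
chain (suc (suc i)) 0 = i ≡ᵇ 0
chain (suc (suc i)) 1 = i ≡ᵇ 0
chain (suc (suc i)) (suc (suc j)) = chain i j

chain-sym : ∀ i j → chain i j ≡ chain j i
chain-sym 0 0 = refl
chain-sym 0 1 = refl
chain-sym 0 2 = refl
chain-sym 0 (suc (suc (suc _))) = refl
chain-sym 1 0 = refl
chain-sym 1 1 = refl
chain-sym 1 2 = refl
chain-sym 1 (suc (suc (suc _))) = refl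
chain-sym 2 0 = refl
chain-sym 2 1 = refl
chain-sym (suc (suc (suc _))) 0 = refl
chain-sym (suc (suc (suc _))) 1 = refl
chain-sym (suc (suc i)) (suc (suc j)) = chain-sym i j

chain-suc : ∀ i → chain (suc i) i ≡ true
chain-suc 0 = refl
chain-suc 1 = refl
chain-suc (suc (suc i)) = chain-suc i

-- The six orderings of a triangle: the first two corners are the edge played,
-- the third one remains.
corners : Vec (ℕ × ℕ × ℕ) 6
corners = (0 , 1 , 2) ∷ (0 , 2 , 1) ∷ (1 , 0 , 2) ∷ (1 , 2 , 0) ∷ (2 , 0 , 1) ∷ (2 , 1 , 0) ∷ []

first second third : Fin 6 → ℕ
first  k = proj₁ (lookup corners k)
second k = proj₁ (proj₂ (lookup corners k))
third  k = proj₂ (proj₂ (lookup corners k))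

-- Used with `refl`: both tables normalise to the same vector, which settles the six orderings of a
-- triangle at once.
by-cases : ∀ {n} {f g : Fin n → Bool} → tabulate f ≡ tabulate g → ∀ k → f k ≡ g k
by-cases {f = f} {g} eq k =
  trans (sym (lookup∘tabulate f k)) (trans (cong (λ v → lookup v k) eq) (lookup∘tabulate g k))

-- Positions have the form `l * 2 + x` because `suc l * 2 + x` reduces to `suc (suc (l * 2 + x))`;
-- moving up by one triangle is then the last clause of `chain`, definitionally.
chain-triangle : ∀ i j → chain i j ≡ true →
  ∃[ l ] ∃[ k ] i ≡ l * 2 + first k × j ≡ l * 2 + second k
chain-triangle 0 1 _ = 0 , zero , refl , refl
chain-triangle 0 2 _ = 0 , suc zero , refl , refl
chain-triangle 1 0 _ = 0 , suc (suc zero) , refl , refl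
chain-triangle 1 2 _ = 0 , suc (suc (suc zero)) , refl , refl
chain-triangle 2 0 _ = 0 , suc (suc (suc (suc zero))) , refl , refl
chain-triangle 2 1 _ = 0 , suc (suc (suc (suc (suc zero)))) , refl , refl
chain-triangle (suc (suc i)) (suc (suc j)) ij with chain-triangle i j ij
... | l , k , refl , refl = suc l , k , refl , refl

-- The chain after a move and its reply.

schur-far : ∀ {X : Set} (g : X → X → Bool) a b p q →
  g a p ≡ false → g b p ≡ false → schur g a b p q ≡ g p q
schur-far g a b p q ap bp rewrite ap | bp = refl

schur-far′ : ∀ {X : Set} (g : X → X → Bool) a b p q →
  g a q ≡ false → g b q ≡ false → schur g a b p q ≡ g p q
schur-far′ g a b p q aq bq rewrite aq | bq | ∧-zeroʳ (g a p) | ∧-zeroʳ (g b p) = refl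

module _ {X : Set} (g : X → X → Bool) (a b c d : X) where

  schur² : X → X → Bool
  schur² = schur (schur g a b) c d

  -- Since `p` sees neither `a` nor `b`, the first complement leaves it non-adjacent to `c` and `d`;
  -- the second one then does not change its row either.
  schur²-far : ∀ p q → g a p ≡ false → g b p ≡ false → g c p ≡ false → g d p ≡ false →
    schur² p q ≡ g p q
  schur²-far p q ap bp cp dp = trans
    (schur-far (schur g a b) c d p q
      (trans (schur-far′ g a b c p ap bp) cp) (trans (schur-far′ g a b d p ap bp) dp))
    (schur-far g a b p q ap bp)

  schur²-far′ : ∀ p q → g a q ≡ false → g b q ≡ false → g c q ≡ false → g d q ≡ false →
    schur² p q ≡ g p q
  schur²-far′ p q aq bq cq dq = trans
    (schur-far′ (schur g a b) c d p q
      (trans (schur-far′ g a b c q aq bq) cq) (trans (schur-far′ g a b d q aq bq) dq))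
    (schur-far′ g a b p q aq bq)

-- Among the positions up to `h * 2`, both removed ones see `h * 2` only, so any two incidence
-- vectors are equal or one of them is zero, and the determinant vanishes.
schur-end : ∀ h i j → i ≤ h * 2 → j ≤ h * 2 →
  schur chain (suc (h * 2)) (suc (suc (h * 2))) i j ≡ chain i j
schur-end zero 0 0 _ _ = refl
schur-end (suc h) 0 j _ _ = refl
schur-end (suc h) 1 j _ _ = refl
schur-end (suc h) i@(suc (suc _)) 0 _ _ =
  schur-far′ chain (suc (suc h * 2)) (suc (suc (suc h * 2))) i 0 refl refl
schur-end (suc h) i@(suc (suc _)) 1 _ _ =
  schur-far′ chain (suc (suc h * 2)) (suc (suc (suc h * 2))) i 1 refl refl
schur-end (suc h) (suc (suc i)) (suc (suc j)) (s≤s (s≤s i≤)) (s≤s (s≤s j≤)) =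
  schur-end h i j i≤ j≤

-- Only `h * 2` among the remaining positions sees the four removed ones. So a correction could
-- occur only on the diagonal, where no loops arise.
schur²-end : ∀ h i j → i ≤ h * 2 → j ≤ h * 2 → ∀ k →
  schur² chain (suc h * 2 + first k) (suc h * 2 + second k) (suc h * 2 + third k) (suc (h * 2))
    i j ≡ chain i j
schur²-end zero 0 0 _ _ = by-cases refl
schur²-end (suc h) (suc (suc i)) (suc (suc j)) (s≤s (s≤s i≤)) (s≤s (s≤s j≤)) =
  schur²-end h i j i≤ j≤
schur²-end (suc h) 0 j _ _ k =
  schur²-far chain (suc (suc h) * 2 + first k) (suc (suc h) * 2 + second k)
    (suc (suc h) * 2 + third k) (suc (suc h * 2)) 0 j refl refl refl refl
schur²-end (suc h) 1 j _ _ k =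
  schur²-far chain (suc (suc h) * 2 + first k) (suc (suc h) * 2 + second k)
    (suc (suc h) * 2 + third k) (suc (suc h * 2)) 1 j refl refl refl refl
schur²-end (suc h) i@(suc (suc _)) 0 _ _ k =
  schur²-far′ chain (suc (suc h) * 2 + first k) (suc (suc h) * 2 + second k)
    (suc (suc h) * 2 + third k) (suc (suc h * 2)) i 0 refl refl refl refl
schur²-end (suc h) i@(suc (suc _)) 1 _ _ k =
  schur²-far′ chain (suc (suc h) * 2 + first k) (suc (suc h) * 2 + second k)
    (suc (suc h) * 2 + third k) (suc (suc h * 2)) i 1 refl refl refl refl

-- The edge played lies in the triangle {2l, 2l+1, 2l+2}.  The reply removes its
-- remaining corner and 2l+d, keeping 2l+c, where {c, d} = {3, 4}; the leaf 2l+3 can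
-- take the place of 2l+4 only in the first triangle, l = 0.
data Choice : ℕ → ℕ → ℕ → Set where
  spine : ∀ {l} → Choice l 4 3
  tip   : Choice 0 3 4

-- skip l c enumerates the positions left after that reply, skip l c (2 * l) = 2 * l + c.
skip : ℕ → ℕ → ℕ → ℕ
skip zero    c 0 = c
skip zero    c (suc i) = 5 + i
skip (suc l) c 0 = 0
skip (suc l) c 1 = 1
skip (suc l) c (suc (suc i)) = suc (suc (skip l c i))

-- Positions 0 and 1 have neighbours only among 0, 1, 2. The enumeration fixes 0 to 3 and sends no
-- later position below 4.
skip-near : ∀ l i j → i ≤ 1 → chain i (skip (suc (suc l)) 4 j) ≡ chain i j
skip-near l 0 0 _ = refl
skip-near l 0 1 _ = refl
skip-near l 0 2 _ = refl
skip-near l 0 3 _ = refl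
skip-near l 0 (suc (suc (suc (suc j)))) _ = refl
skip-near l 1 0 _ = refl
skip-near l 1 1 _ = refl
skip-near l 1 2 _ = refl
skip-near l 1 3 _ = refl
skip-near l 1 (suc (suc (suc (suc j)))) _ = refl
skip-near l (suc (suc i)) j (s≤s ())

skip-near′ : ∀ l i j → j ≤ 1 → chain (skip (suc (suc l)) 4 i) j ≡ chain i j
skip-near′ l i j j≤1 = trans (chain-sym (skip (suc (suc l)) 4 i) j)
  (trans (skip-near l j i j≤1) (chain-sym j i))

-- The position 2l+c takes over the role of 2l: with `spine` it keeps its neighbours 2l+5, 2l+6 and
-- gains 2l-2, 2l-1 if l is positive; with `tip` it gains 5 and 6. The induction strips triangles on
-- the left until the hit one is the first.
schur²-skip : ∀ l {c d} → Choice l c d → ∀ i j k →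
  schur² chain (l * 2 + first k) (l * 2 + second k) (l * 2 + third k) (l * 2 + d)
    (skip l c i) (skip l c j) ≡ chain i j
schur²-skip 0 spine 0 0 = by-cases refl
schur²-skip 0 spine 0 (suc j) = by-cases refl
schur²-skip 0 spine (suc i) 0 = by-cases refl
schur²-skip 0 spine (suc i) (suc j) = by-cases refl
schur²-skip 0 tip 0 0 = by-cases refl
schur²-skip 0 tip 0 1 = by-cases refl
schur²-skip 0 tip 0 2 = by-cases refl
schur²-skip 0 tip 0 (suc (suc (suc j))) = by-cases refl
schur²-skip 0 tip 1 0 = by-cases refl
schur²-skip 0 tip 1 1 = by-cases refl
schur²-skip 0 tip 1 2 = by-cases refl
schur²-skip 0 tip 1 (suc (suc (suc j))) = by-cases refl
schur²-skip 0 tip 2 0 = by-cases refl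
schur²-skip 0 tip 2 1 = by-cases refl
schur²-skip 0 tip 2 2 = by-cases refl
schur²-skip 0 tip 2 (suc (suc (suc j))) = by-cases refl
schur²-skip 0 tip (suc (suc (suc i))) 0 = by-cases refl
schur²-skip 0 tip (suc (suc (suc i))) 1 = by-cases refl
schur²-skip 0 tip (suc (suc (suc i))) 2 = by-cases refl
schur²-skip 0 tip (suc (suc (suc i))) (suc (suc (suc j))) = by-cases refl
schur²-skip (suc l) spine (suc (suc i)) (suc (suc j)) = schur²-skip l spine i j
schur²-skip 1 spine 0 0 = by-cases refl
schur²-skip 1 spine 0 1 = by-cases refl
schur²-skip 1 spine 0 2 = by-cases refl
schur²-skip 1 spine 0 (suc (suc (suc j))) = by-cases refl
schur²-skip 1 spine 1 0 = by-cases refl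
schur²-skip 1 spine 1 1 = by-cases refl
schur²-skip 1 spine 1 2 = by-cases refl
schur²-skip 1 spine 1 (suc (suc (suc j))) = by-cases refl
schur²-skip 1 spine 2 0 = by-cases refl
schur²-skip 1 spine 2 1 = by-cases refl
schur²-skip 1 spine (suc (suc (suc i))) 0 = by-cases refl
schur²-skip 1 spine (suc (suc (suc i))) 1 = by-cases refl
-- From the third triangle on, every removed position is at least 4, out of reach of 0 and 1.
schur²-skip (suc (suc l)) spine 0 j k = trans
  (schur²-far chain (suc (suc l) * 2 + first k) (suc (suc l) * 2 + second k)
    (suc (suc l) * 2 + third k) (suc (suc l) * 2 + 3) 0 (skip (suc (suc l)) 4 j) refl refl refl refl)
  (skip-near l 0 j z≤n)
schur²-skip (suc (suc l)) spine 1 j k = trans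
  (schur²-far chain (suc (suc l) * 2 + first k) (suc (suc l) * 2 + second k)
    (suc (suc l) * 2 + third k) (suc (suc l) * 2 + 3) 1 (skip (suc (suc l)) 4 j) refl refl refl refl)
  (skip-near l 1 j ≤-refl)
schur²-skip (suc (suc l)) spine i@(suc (suc _)) 0 k = trans
  (schur²-far′ chain (suc (suc l) * 2 + first k) (suc (suc l) * 2 + second k)
    (suc (suc l) * 2 + third k) (suc (suc l) * 2 + 3) (skip (suc (suc l)) 4 i) 0 refl refl refl refl)
  (skip-near′ l i 0 z≤n)
schur²-skip (suc (suc l)) spine i@(suc (suc _)) 1 k = trans
  (schur²-far′ chain (suc (suc l) * 2 + first k) (suc (suc l) * 2 + second k)
    (suc (suc l) * 2 + third k) (suc (suc l) * 2 + 3) (skip (suc (suc l)) 4 i) 1 refl refl refl refl)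
  (skip-near′ l i 1 ≤-refl)

-- Ranges of the removed and remaining positions.

corners-cover : ∀ k {i} → i < 3 → i ≡ first k ⊎ i ≡ second k ⊎ i ≡ third k
corners-cover k i<3 with cover k (fromℕ< i<3)
  where
  cover : ∀ k (i : Fin 3) → toℕ i ≡ first k ⊎ toℕ i ≡ second k ⊎ toℕ i ≡ third k
  cover = toWitness {a? = Fin.all? λ k → Fin.all? λ i →
    (toℕ i ≟ first k) ⊎-dec ((toℕ i ≟ second k) ⊎-dec (toℕ i ≟ third k))} _
... | c rewrite Fin.toℕ-fromℕ< i<3 = c

corners-avoided : ∀ k {i} → i ≢ first k → i ≢ second k → i ≢ third k → 3 ≤ i
corners-avoided k ≢a ≢b ≢r = ≮⇒≥ λ i<3 → case corners-cover k i<3 of λ where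
  (inj₁ eq)        → ≢a eq
  (inj₂ (inj₁ eq)) → ≢b eq
  (inj₂ (inj₂ eq)) → ≢r eq

corners≤2 : ∀ k → first k ≤ 2 × second k ≤ 2 × third k ≤ 2
corners≤2 = toWitness
  {a? = Fin.all? λ k → (first k ≤? 2) ×-dec ((second k ≤? 2) ×-dec (third k ≤? 2))} _

edge-leaves-0 : ∀ k → 1 ≤ first k ⊎ 1 ≤ second k
edge-leaves-0 = toWitness {a? = Fin.all? λ k → (1 ≤? first k) ⊎-dec (1 ≤? second k)} _

skip-edge : ∀ l {c d} → Choice l c d → ∀ k →
  schur chain (l * 2 + first k) (l * 2 + second k) (l * 2 + third k) (l * 2 + d) ≡ true
skip-edge zero    spine = by-cases refl
skip-edge zero    tip   = by-cases refl
skip-edge (suc l) spine = skip-edge l spine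

skip-≤ : ∀ l {c d} → Choice l c d → ∀ h i → l ≤ h → i ≤ h * 2 → skip l c i ≤ 4 + h * 2
skip-≤ zero spine h 0 _ _ = m≤m+n 4 (h * 2)
skip-≤ zero tip h 0 _ _ = m≤m+n 3 (suc (h * 2))
skip-≤ zero _ h (suc i) _ i≤ = +-monoʳ-≤ 4 i≤
skip-≤ (suc l) spine h 0 _ _ = z≤n
skip-≤ (suc l) spine h 1 _ _ = s≤s z≤n
skip-≤ (suc l) spine (suc h) (suc (suc i)) (s≤s l≤h) (s≤s (s≤s i≤)) =
  +-monoʳ-≤ 2 (skip-≤ l spine h i l≤h i≤)

skip-onto : ∀ l k {c d} → Choice l c d → ∀ h {i} → l ≤ h → i ≤ 4 + h * 2 →
  i ≢ l * 2 + first k → i ≢ l * 2 + second k → i ≢ l * 2 + third k → i ≢ l * 2 + d →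
  ∃[ j ] j ≤ h * 2 × skip l c j ≡ i
skip-onto zero k ch h l≤h i≤ ≢a ≢b ≢r ≢d with corners-avoided k ≢a ≢b ≢r
skip-onto zero k spine h {3} _ _ _ _ _ ≢d | _ = ⊥-elim (≢d refl)
skip-onto zero k tip   h {3} _ _ _ _ _ ≢d | _ = 0 , z≤n , refl
skip-onto zero k spine h {4} _ _ _ _ _ ≢d | _ = 0 , z≤n , refl
skip-onto zero k tip   h {4} _ _ _ _ _ ≢d | _ = ⊥-elim (≢d refl)
skip-onto zero k ch h {suc (suc (suc (suc (suc i))))} _ (s≤s (s≤s (s≤s (s≤s i≤)))) _ _ _ _ | _ =
  suc i , i≤ , refl
skip-onto zero k ch h {1} _ _ _ _ _ _ | s≤s ()
skip-onto zero k ch h {2} _ _ _ _ _ _ | s≤s (s≤s ())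
skip-onto (suc l) k spine h {0} _ _ _ _ _ _ = 0 , z≤n , refl
skip-onto (suc l) k spine (suc h) {1} _ _ _ _ _ _ = 1 , s≤s z≤n , refl
skip-onto (suc l) k spine (suc h) {suc (suc i)} (s≤s l≤h) (s≤s (s≤s i≤)) ≢a ≢b ≢r ≢d
  with skip-onto l k spine h l≤h i≤
         (≢a ∘ cong (2 +_)) (≢b ∘ cong (2 +_)) (≢r ∘ cong (2 +_)) (≢d ∘ cong (2 +_))
... | j , j≤ , refl = suc (suc j) , s≤s (s≤s j≤) , refl

-- If the last triangle is hit, the reply removes the leaf of the triangle before it.
end-edge : ∀ h k → schur chain (suc h * 2 + first k) (suc h * 2 + second k)
  (suc h * 2 + third k) (suc (h * 2)) ≡ true
end-edge zero    = by-cases refl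
end-edge (suc h) = end-edge h

end-onto : ∀ h k {i} → i ≤ 4 + h * 2 →
  i ≢ suc h * 2 + first k → i ≢ suc h * 2 + second k → i ≢ suc h * 2 + third k →
  i ≢ suc (h * 2) →
  i ≤ h * 2
end-onto h k {0} _ _ _ _ _ = z≤n
end-onto zero k {1} _ _ _ _ ≢d = ⊥-elim (≢d refl)
end-onto zero k {suc (suc i)} (s≤s (s≤s i≤2)) ≢a ≢b ≢r _ =
  ⊥-elim (<⇒≱ (s≤s i≤2)
    (corners-avoided k (≢a ∘ cong (2 +_)) (≢b ∘ cong (2 +_)) (≢r ∘ cong (2 +_))))
end-onto (suc h) k {1} _ _ _ _ _ = s≤s z≤n
end-onto (suc h) k {suc (suc i)} (s≤s (s≤s i≤)) ≢a ≢b ≢r ≢d =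
  s≤s (s≤s (end-onto h k i≤
    (≢a ∘ cong (2 +_)) (≢b ∘ cong (2 +_)) (≢r ∘ cong (2 +_)) (≢d ∘ cong (2 +_))))

-- Two distinct corners are not both the lowest one, so the edge has an endpoint at 2l+1 or beyond.
edge-triangle-≤ : ∀ l h k →
  l * 2 + first k ≤ 4 + h * 2 → l * 2 + second k ≤ 4 + h * 2 → l ≤ suc h
edge-triangle-≤ l h k a≤ b≤ = ≮⇒≥ λ h<l → n≮n (4 + h * 2) (≤-trans (large h<l) top)
  where
  top : l * 2 + 1 ≤ 4 + h * 2
  top with edge-leaves-0 k
  ... | inj₁ 1≤a = ≤-trans (+-monoʳ-≤ (l * 2) 1≤a) a≤
  ... | inj₂ 1≤b = ≤-trans (+-monoʳ-≤ (l * 2) 1≤b) b≤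
  large : suc (suc h) ≤ l → 5 + h * 2 ≤ l * 2 + 1
  large h<l = ≤-trans (≤-reflexive (+-comm 1 (4 + h * 2))) (+-monoˡ-≤ 1 (*-monoˡ-≤ 2 h<l))

-- The common shape of `id` and `skip`, which is all that the label invariants use: every position
-- keeps its label or takes the one four places on, except that position 0 may take the label at
-- `c`, which is 3 or 4.
Thinning : ℕ → (ℕ → ℕ) → Set
Thinning c ψ = (ψ 0 ≡ 0 ⊎ ψ 0 ≡ c) × (∀ i → ψ (suc i) ≡ suc i ⊎ ψ (suc i) ≡ 5 + i)

skip-shift : ∀ l i → skip l 4 i ≡ i ⊎ skip l 4 i ≡ 4 + i
skip-shift zero 0 = inj₂ refl
skip-shift zero (suc i) = inj₂ refl
skip-shift (suc l) 0 = inj₁ refl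
skip-shift (suc l) 1 = inj₁ refl
skip-shift (suc l) (suc (suc i)) with skip-shift l i
... | inj₁ eq = inj₁ (cong (2 +_) eq)
... | inj₂ eq = inj₂ (cong (2 +_) eq)

-- Labelled triangle chains and the replies.

module _ {X : Set} (_≟ˣ_ : DecidableEquality X) where

  open Transformation _≟ˣ_ using (gcds₂)
  open GraphLemmas _≟ˣ_

  AdjacentBy : ℕ → Graph X → (ℕ → X) → (ℕ → ℕ → Bool) → Set
  AdjacentBy n C φ g = ∀ i j → i ≤ n → j ≤ n → adj C (φ i) (φ j) ≡ g i j

  adjacent-gcds₂ : ∀ {n C φ g a b} → AdjacentBy n C φ g → a ≤ n → b ≤ n →
    (ab : adj C (φ a) (φ b) ≡ true) → AdjacentBy n (gcds₂ C (φ a , φ b , ab)) φ (schur g a b)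
  adjacent-gcds₂ {C = C} {φ} {a = a} {b} H a≤ b≤ ab i j i≤ j≤
    rewrite gcdsAdj≡schur C (φ a , φ b , ab) (φ i) (φ j)
          | H a i a≤ i≤ | H b j b≤ j≤ | H b i b≤ i≤ | H a j a≤ j≤ | H i j i≤ j≤ = refl

  -- The number of triangles is `h`; for `h = 0` the graph is a single vertex. The labelling `φ` is
  -- total so that it composes with `skip` and `swap`; only its values up to `h * 2` are
  -- constrained.
  record TriangleChain (h : ℕ) (C : Graph X) (φ : ℕ → X) : Set where
    field
      into     : ∀ i → i ≤ h * 2 → φ i ∈ V C
      onto     : ∀ {v} → v ∈ V C → ∃[ i ] i ≤ h * 2 × φ i ≡ v
      adjacent : AdjacentBy (h * 2) C φ chain

  open TriangleChain

  -- If there is a triangle, every position has a neighbour, and endpoints of edges are vertices. So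
  -- survival of a vertex has to be checked only when a single one is left.
  mkChain : ∀ {h C φ} → (h ≡ 0 → φ 0 ∈ V C) →
    (∀ {v} → v ∈ V C → ∃[ i ] i ≤ h * 2 × φ i ≡ v) →
    AdjacentBy (h * 2) C φ chain → TriangleChain h C φ
  mkChain {h} {C} {φ} single onto H = record { into = into′ h single H ; onto = onto ; adjacent = H }
    where
    into′ : ∀ h → (h ≡ 0 → φ 0 ∈ V C) → AdjacentBy (h * 2) C φ chain →
      ∀ i → i ≤ h * 2 → φ i ∈ V C
    into′ zero    single H 0 _ = single refl
    into′ (suc h) single H 0 _ = adj-in-V C (φ 0) (φ 1) (H 0 1 z≤n (s≤s z≤n))
    into′ (suc h) single H (suc i) i<  =
      adj-in-V C (φ (suc i)) (φ i) (trans (H (suc i) i i< (<⇒≤ i<)) (chain-suc i))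

  last-triangle : ∀ {h C φ} → TriangleChain (suc h) C φ →
    Σ[ e ∈ Edge C ] TriangleChain h (gcds₂ C e) φ
  last-triangle {h} {C} {φ} K = e , mkChain single onto′
    (λ i j i≤ j≤ → trans
      (adjacent-gcds₂ {C = C} (adjacent K) a≤ ≤-refl ab i j (≤2+ i≤) (≤2+ j≤))
      (schur-end h i j i≤ j≤))
    where
    a b : ℕ
    a = suc (h * 2)
    b = suc a
    a≤ : a ≤ b
    a≤ = n≤1+n a
    ≤2+ : ∀ {i} → i ≤ h * 2 → i ≤ b
    ≤2+ i≤ = ≤-trans i≤ (m≤n+m (h * 2) 2)
    ab : adj C (φ a) (φ b) ≡ true
    ab = trans (adjacent K a b a≤ ≤-refl) (trans (chain-sym a b) (chain-suc a))
    e : Edge C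
    e = φ a , φ b , ab
    onto′ : ∀ {v} → v ∈ V (gcds₂ C e) → ∃[ i ] i ≤ h * 2 × φ i ≡ v
    onto′ v∈ with ∈-gcds₂⁻ C e v∈
    ... | v∈C , ≢a , ≢b with onto K v∈C
    ... | i , i≤ , refl =
      i , ≤-pred (≤∧≢⇒< (≤-pred (≤∧≢⇒< i≤ (≢b ∘ cong φ))) (≢a ∘ cong φ)) , refl
    -- The last vertex becomes isolated, but it is alone in the master list and therefore stays.
    single : h ≡ 0 → φ 0 ∈ V (gcds₂ C e)
    single refl = third-vertex-stays C e
      (adjacent K 0 1 z≤n (s≤s z≤n)) (adjacent K 0 2 z≤n ≤-refl) only
      where
      only : ∀ {w} → w ∈ V C → w ≡ φ 1 ⊎ w ≡ φ 2 ⊎ w ≡ φ 0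
      only w∈ with onto K w∈
      ... | 0 , _ , refl = inj₂ (inj₂ refl)
      ... | 1 , _ , refl = inj₁ refl
      ... | 2 , _ , refl = inj₂ (inj₁ refl)
      ... | suc (suc (suc _)) , s≤s (s≤s ()) , _

  -- Common core of the replies: {a, b} is played, {c, d} answers it, and `ψ` enumerates what is
  -- left. The last hypothesis serves the end of the game: before the final move the survivor is
  -- joined to both `c` and `d`, so it is the whole master list.
  two-moves : ∀ {h C φ} → TriangleChain (2 + h) C φ → ∀ {a b c d} →
    a ≤ (2 + h) * 2 → b ≤ (2 + h) * 2 → c ≤ (2 + h) * 2 → d ≤ (2 + h) * 2 →
    (ab : adj C (φ a) (φ b) ≡ true) → schur chain a b c d ≡ true → ∀ ψ →
    (∀ i → i ≤ h * 2 → ψ i ≤ (2 + h) * 2) →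
    (∀ i → i ≤ (2 + h) * 2 → i ≢ a → i ≢ b → i ≢ c → i ≢ d →
      ∃[ j ] j ≤ h * 2 × ψ j ≡ i) →
    (∀ i j → i ≤ h * 2 → j ≤ h * 2 → schur² chain a b c d (ψ i) (ψ j) ≡ chain i j) →
    (h ≡ 0 → schur chain a b (ψ 0) c ≡ true × schur chain a b (ψ 0) d ≡ true) →
    Σ[ e ∈ Edge (gcds₂ C (φ a , φ b , ab)) ]
      TriangleChain h (gcds₂ (gcds₂ C (φ a , φ b , ab)) e) (φ ∘ ψ)
  two-moves {h} {C} {φ} K {a} {b} {c} {d} a≤ b≤ c≤ d≤ ab cd ψ ψ≤ cover isom rest =
    e , mkChain single onto₂
      (λ i j i≤ j≤ → trans
        (adjacent-gcds₂ {C = C₁} H₁ c≤ d≤ cd′ (ψ i) (ψ j) (ψ≤ i i≤) (ψ≤ j j≤))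
        (isom i j i≤ j≤))
    where
    C₁ : Graph X
    C₁ = gcds₂ C (φ a , φ b , ab)
    H₁ : AdjacentBy ((2 + h) * 2) C₁ φ (schur chain a b)
    H₁ = adjacent-gcds₂ {C = C} (adjacent K) a≤ b≤ ab
    cd′ : adj C₁ (φ c) (φ d) ≡ true
    cd′ = trans (H₁ c d c≤ d≤) cd
    e : Edge C₁
    e = φ c , φ d , cd′
    onto₁ : ∀ {v} → v ∈ V C₁ → ∃[ i ] i ≤ (2 + h) * 2 × i ≢ a × i ≢ b × φ i ≡ v
    onto₁ v∈ with ∈-gcds₂⁻ C (φ a , φ b , ab) v∈
    ... | v∈C , ≢a , ≢b with onto K v∈C
    ... | i , i≤ , refl = i , i≤ , ≢a ∘ cong φ , ≢b ∘ cong φ , refl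
    onto₂ : ∀ {v} → v ∈ V (gcds₂ C₁ e) → ∃[ i ] i ≤ h * 2 × φ (ψ i) ≡ v
    onto₂ v∈ with ∈-gcds₂⁻ C₁ e v∈
    ... | v∈C₁ , ≢c , ≢d with onto₁ v∈C₁
    ... | i , i≤ , ≢a , ≢b , refl with cover i i≤ ≢a ≢b (≢c ∘ cong φ) (≢d ∘ cong φ)
    ... | j , j≤ , refl = j , j≤ , refl
    single : h ≡ 0 → φ (ψ 0) ∈ V (gcds₂ C₁ e)
    single refl = third-vertex-stays C₁ e
      (trans (H₁ (ψ 0) c (ψ≤ 0 z≤n) c≤) (proj₁ (rest refl)))
      (trans (H₁ (ψ 0) d (ψ≤ 0 z≤n) d≤) (proj₂ (rest refl))) only
      where
      only : ∀ {w} → w ∈ V C₁ → w ≡ φ c ⊎ w ≡ φ d ⊎ w ≡ φ (ψ 0)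
      only w∈ with onto₁ w∈
      ... | i , i≤ , ≢a , ≢b , refl with i ≟ c | i ≟ d
      ...   | yes refl | _        = inj₁ refl
      ...   | no _     | yes refl = inj₂ (inj₁ refl)
      ...   | no ≢c    | no ≢d with cover i i≤ ≢a ≢b ≢c ≢d
      ...     | 0 , _ , refl = inj₂ (inj₂ refl)

  reply-skip : ∀ {h C φ} → TriangleChain (2 + h) C φ → ∀ l k {c d} → Choice l c d → l ≤ h →
    (ab : adj C (φ (l * 2 + first k)) (φ (l * 2 + second k)) ≡ true) →
    Σ[ e ∈ Edge (gcds₂ C (_ , _ , ab)) ]
      TriangleChain h (gcds₂ (gcds₂ C (_ , _ , ab)) e) (φ ∘ skip l c)
  reply-skip {h} K l k {c} {d} ch l≤h ab =
    two-moves K (bound (two (proj₁ c≤))) (bound (two (proj₁ (proj₂ c≤))))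
      (bound (two (proj₂ (proj₂ c≤)))) (bound (d≤4 ch)) ab
      (skip-edge l ch k) (skip l c) (λ i → skip-≤ l ch h i l≤h)
      (λ i → skip-onto l k ch h l≤h) (λ i j _ _ → schur²-skip l ch i j k) (rest l ch l≤h)
    where
    c≤ = corners≤2 k
    two : ∀ {x} → x ≤ 2 → x ≤ 4
    two x≤ = ≤-trans x≤ (m≤n+m 2 2)
    bound : ∀ {x} → x ≤ 4 → l * 2 + x ≤ 4 + h * 2
    bound x≤ = ≤-trans (+-mono-≤ (*-monoˡ-≤ 2 l≤h) x≤) (≤-reflexive (+-comm (h * 2) 4))
    d≤4 : ∀ {l c d} → Choice l c d → d ≤ 4
    d≤4 spine = n≤1+n 3
    d≤4 tip   = ≤-refl
    rest : ∀ l {c d} → Choice l c d → l ≤ h → h ≡ 0 →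
      schur chain (l * 2 + first k) (l * 2 + second k) (skip l c 0) (l * 2 + third k) ≡ true ×
      schur chain (l * 2 + first k) (l * 2 + second k) (skip l c 0) (l * 2 + d) ≡ true
    rest zero spine z≤n _ = spine-third k , spine-d k
      where
      spine-third : ∀ k → schur chain (first k) (second k) 4 (third k) ≡ true
      spine-third = by-cases refl
      spine-d : ∀ k → schur chain (first k) (second k) 4 3 ≡ true
      spine-d = by-cases refl
    rest zero tip z≤n _ = tip-third k , tip-d k
      where
      tip-third : ∀ k → schur chain (first k) (second k) 3 (third k) ≡ true
      tip-third = by-cases refl
      tip-d : ∀ k → schur chain (first k) (second k) 3 4 ≡ true
      tip-d = by-cases refl
    rest (suc l) _ () refl

  reply-end : ∀ {h C φ} → TriangleChain (2 + h) C φ → ∀ k →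
    (ab : adj C (φ (suc h * 2 + first k)) (φ (suc h * 2 + second k)) ≡ true) →
    Σ[ e ∈ Edge (gcds₂ C (_ , _ , ab)) ] TriangleChain h (gcds₂ (gcds₂ C (_ , _ , ab)) e) φ
  reply-end {h} K k ab =
    two-moves K (bound (proj₁ c≤)) (bound (proj₁ (proj₂ c≤))) (bound (proj₂ (proj₂ c≤)))
      (m≤n+m (suc (h * 2)) 3) ab
      (end-edge h k) id (λ i i≤ → ≤-trans i≤ (m≤n+m (h * 2) 4))
      (λ i i≤ ≢a ≢b ≢c ≢d → i , end-onto h k i≤ ≢a ≢b ≢c ≢d , refl)
      (λ i j i≤ j≤ → schur²-end h i j i≤ j≤ k) rest
    where
    c≤ = corners≤2 k
    bound : ∀ {x} → x ≤ 2 → suc h * 2 + x ≤ 4 + h * 2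
    bound x≤ = ≤-trans (+-monoʳ-≤ (suc h * 2) x≤) (≤-reflexive (+-comm (suc h * 2) 2))
    rest : h ≡ 0 →
      schur chain (suc h * 2 + first k) (suc h * 2 + second k) 0 (suc h * 2 + third k) ≡ true ×
      schur chain (suc h * 2 + first k) (suc h * 2 + second k) 0 (suc (h * 2)) ≡ true
    rest refl = third′ k , stem k
      where
      third′ : ∀ k → schur chain (2 + first k) (2 + second k) 0 (2 + third k) ≡ true
      third′ = by-cases refl
      stem : ∀ k → schur chain (2 + first k) (2 + second k) 0 1 ≡ true
      stem = by-cases refl

  -- The last triangle is answered by `reply-end`, all others by `reply-skip`. The given choice
  -- decides only about the first triangle, where ONE will use `tip` and TWO `spine`.
  reply : ∀ {h C φ c d} → Choice 0 c d → TriangleChain (2 + h) C φ → (e : Edge C) →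
    Σ[ e′ ∈ Edge (gcds₂ C e) ] ∃[ ψ ]
      Thinning c ψ × TriangleChain h (gcds₂ (gcds₂ C e) e′) (φ ∘ ψ)
  reply {h} {C} {φ} ch K (x , y , xy)
    with onto K (adj-in-V C x y xy) | onto K (adj-in-V C y x (trans (adj-sym C y x) xy))
  ... | i , i≤ , refl | j , j≤ , refl with chain-triangle i j (trans (sym (adjacent K i j i≤ j≤)) xy)
  ... | l , k , refl , refl with m≤n⇒m<n∨m≡n (edge-triangle-≤ l h k i≤ j≤)
  ... | inj₂ refl = let e , K′ = reply-end K k xy in e , id , (inj₁ refl , λ _ → inj₁ refl) , K′
  reply ch K (_ , _ , xy) | _ , _ , refl | _ , _ , refl | zero , k , refl , refl | inj₁ _ =
    let e , K′ = reply-skip K 0 k ch z≤n xy in e , skip 0 _ , (inj₂ refl , λ _ → inj₂ refl) , K′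
  reply ch K (_ , _ , xy) | _ , _ , refl | _ , _ , refl | suc l , k , refl , refl | inj₁ (s≤s l<h) =
    let e , K′ = reply-skip K (suc l) k spine l<h xy
    in e , skip (suc l) 4 , (inj₁ refl , λ i → skip-shift (suc l) (suc i)) , K′

-- The graphs `𝒢 n` as triangle chains.

triangle-outside : ∀ n p j → j ≤ 1 → triangle (3 + n) (4 + n) (5 + n) p (suc j) ≡ false
triangle-outside n p 0 _
  rewrite ∧-zeroʳ (p ≡ᵇ 3 + n) | ∧-zeroʳ (p ≡ᵇ 4 + n) | ∧-zeroʳ (p ≡ᵇ 5 + n) = refl
triangle-outside n p 1 _
  rewrite ∧-zeroʳ (p ≡ᵇ 3 + n) | ∧-zeroʳ (p ≡ᵇ 4 + n) | ∧-zeroʳ (p ≡ᵇ 5 + n) = refl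
triangle-outside n p (suc (suc j)) (s≤s ())

-- The only corner of the new triangle among the old positions is `n * 2`, and a triangle has no
-- loops.
triangle-earlier : ∀ n i j → i ≤ n * 2 → j ≤ n * 2 →
  triangle (suc (n * 2)) (2 + n * 2) (3 + n * 2) (suc i) (suc j) ≡ false
triangle-earlier zero 0 0 _ _ = refl
triangle-earlier (suc n) 0 j _ _ = refl
triangle-earlier (suc n) 1 j _ _ = refl
triangle-earlier (suc n) (suc (suc i)) 0 _ _ = triangle-outside (n * 2) (3 + i) 0 z≤n
triangle-earlier (suc n) (suc (suc i)) 1 _ _ = triangle-outside (n * 2) (3 + i) 1 ≤-refl
triangle-earlier (suc n) (suc (suc i)) (suc (suc j)) (s≤s (s≤s i≤)) (s≤s (s≤s j≤)) =
  triangle-earlier n i j i≤ j≤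

-- Within the bound, a position beyond `n * 2` belongs to no other triangle with both ends of an
-- edge in range.
triangle-chain : ∀ n i j → i ≤ suc n * 2 → j ≤ suc n * 2 → n * 2 < i ⊎ n * 2 < j →
  triangle (suc (n * 2)) (2 + n * 2) (3 + n * 2) (suc i) (suc j) ≡ chain i j
triangle-chain zero 0 0 _ _ _ = refl
triangle-chain zero 0 1 _ _ _ = refl
triangle-chain zero 0 2 _ _ _ = refl
triangle-chain zero 1 0 _ _ _ = refl
triangle-chain zero 1 1 _ _ _ = refl
triangle-chain zero 1 2 _ _ _ = refl
triangle-chain zero 2 0 _ _ _ = refl
triangle-chain zero 2 1 _ _ _ = refl
triangle-chain zero 2 2 _ _ _ = refl
triangle-chain zero (suc (suc (suc _))) _ (s≤s (s≤s ())) _ _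
triangle-chain zero _ (suc (suc (suc _))) _ (s≤s (s≤s ())) _
triangle-chain (suc n) 0 (suc (suc (suc j))) _ _ _ = refl
triangle-chain (suc n) 1 (suc (suc (suc j))) _ _ _ = refl
triangle-chain (suc n) (suc (suc (suc i))) 0 _ _ _ = triangle-outside (n * 2) (4 + i) 0 z≤n
triangle-chain (suc n) (suc (suc (suc i))) 1 _ _ _ = triangle-outside (n * 2) (4 + i) 1 ≤-refl
triangle-chain (suc n) (suc (suc i)) (suc (suc j)) (s≤s (s≤s i≤)) (s≤s (s≤s j≤)) new =
  triangle-chain n i j i≤ j≤ (Sum.map (≤-pred ∘ ≤-pred) (≤-pred ∘ ≤-pred) new)
triangle-chain (suc n) 0 0 _ _ (inj₁ ())
triangle-chain (suc n) 0 0 _ _ (inj₂ ())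
triangle-chain (suc n) 0 1 _ _ (inj₁ ())
triangle-chain (suc n) 0 1 _ _ (inj₂ (s≤s ()))
triangle-chain (suc n) 0 2 _ _ (inj₁ ())
triangle-chain (suc n) 0 2 _ _ (inj₂ (s≤s (s≤s ())))
triangle-chain (suc n) 1 0 _ _ (inj₁ (s≤s ()))
triangle-chain (suc n) 1 0 _ _ (inj₂ ())
triangle-chain (suc n) 1 1 _ _ (inj₁ (s≤s ()))
triangle-chain (suc n) 1 1 _ _ (inj₂ (s≤s ()))
triangle-chain (suc n) 1 2 _ _ (inj₁ (s≤s ()))
triangle-chain (suc n) 1 2 _ _ (inj₂ (s≤s (s≤s ())))
triangle-chain (suc n) 2 0 _ _ (inj₁ (s≤s (s≤s ())))
triangle-chain (suc n) 2 0 _ _ (inj₂ ())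
triangle-chain (suc n) 2 1 _ _ (inj₁ (s≤s (s≤s ())))
triangle-chain (suc n) 2 1 _ _ (inj₂ (s≤s ()))

vertices-bound : ∀ n {i} → suc i ∈ vertices n → i ≤ n * 2
vertices-bound n i∈ with ∈-applyUpTo⁻ suc i∈
... | i , i< , refl = ≤-pred (≤-trans i< (≤-reflexive
  (trans (+-comm (2 * n) 1) (cong suc (*-comm 2 n)))))

vertices-member : ∀ n {i} → i ≤ n * 2 → suc i ∈ vertices n
vertices-member n i≤ = ∈-applyUpTo⁺ suc (≤-trans (s≤s i≤) (≤-reflexive
  (trans (cong suc (*-comm n 2)) (+-comm 1 (2 * n)))))

𝒢-outside : ∀ n .{{_ : NonZero n}} i j → n * 2 < i ⊎ n * 2 < j →
  𝒢-adj n (suc i) (suc j) ≡ false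
𝒢-outside n i j out with 𝒢-adj n (suc i) (suc j) in ij
... | false = refl
... | true  = ⊥-elim ([ (λ i> → <⇒≱ i> (vertices-bound n (adj-in-V (𝒢 n) (suc i) (suc j) ij)))
                      , (λ j> → <⇒≱ j> (vertices-bound n (adj-in-V (𝒢 n) (suc j) (suc i)
                          (trans (adj-sym (𝒢 n) (suc j) (suc i)) ij)))) ] out)

corners-*2 : ∀ n p q →
  triangle (2 * n + 1) (2 * n + 2) (2 * n + 3) p q ≡ triangle (suc (n * 2)) (2 + n * 2) (3 + n * 2) p q
corners-*2 n p q rewrite *-comm 2 n | +-comm (n * 2) 1 | +-comm (n * 2) 2 | +-comm (n * 2) 3 = refl

𝒢-chain-suc : ∀ n .{{_ : NonZero n}} i j → i ≤ suc n * 2 → j ≤ suc n * 2 →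
  (i ≤ n * 2 → j ≤ n * 2 → 𝒢-adj n (suc i) (suc j) ≡ chain i j) →
  𝒢-adj n (suc i) (suc j) ∨ triangle (2 * n + 1) (2 * n + 2) (2 * n + 3) (suc i) (suc j) ≡ chain i j
𝒢-chain-suc n i j i≤ j≤ old with n * 2 <? i | n * 2 <? j
... | yes i> | _      = cong₂ _∨_ (𝒢-outside n i j (inj₁ i>))
                          (trans (corners-*2 n (suc i) (suc j)) (triangle-chain n i j i≤ j≤ (inj₁ i>)))
... | no _   | yes j> = cong₂ _∨_ (𝒢-outside n i j (inj₂ j>))
                          (trans (corners-*2 n (suc i) (suc j)) (triangle-chain n i j i≤ j≤ (inj₂ j>)))
... | no i≯  | no j≯  = trans (cong₂ _∨_ (old (≮⇒≥ i≯) (≮⇒≥ j≯))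
                          (trans (corners-*2 n (suc i) (suc j))
                            (triangle-earlier n i j (≮⇒≥ i≯) (≮⇒≥ j≯))))
                          (∨-identityʳ _)

𝒢-chain : ∀ n .{{_ : NonZero n}} i j → i ≤ n * 2 → j ≤ n * 2 →
  𝒢-adj n (suc i) (suc j) ≡ chain i j
𝒢-chain 1 0 0 _ _ = refl
𝒢-chain 1 i@(suc _) j i≤ j≤ = triangle-chain 0 i j i≤ j≤ (inj₁ (s≤s z≤n))
𝒢-chain 1 i j@(suc _) i≤ j≤ = triangle-chain 0 i j i≤ j≤ (inj₂ (s≤s z≤n))
𝒢-chain (suc n@(suc _)) i j i≤ j≤ = 𝒢-chain-suc n i j i≤ j≤ (𝒢-chain n i j)

𝒢-triangleChain : ∀ n .{{_ : NonZero n}} → TriangleChain _≟_ n (𝒢 n) suc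
𝒢-triangleChain n = record
  { into     = λ i → vertices-member n
  ; onto     = onto
  ; adjacent = 𝒢-chain n
  }
  where
  onto : ∀ {v} → v ∈ vertices n → ∃[ i ] i ≤ n * 2 × suc i ≡ v
  onto v∈ with ∈-applyUpTo⁻ suc v∈
  ... | i , _ , refl = i , vertices-bound n v∈ , refl

-- The symmetry of the first triangle.

swap : ℕ → ℕ
swap 0 = 1
swap 1 = 0
swap i@(suc (suc _)) = i

-- Positions 0 and 1 are twins: each sees just the other one and 2.
chain-swap : ∀ i j → chain (swap i) (swap j) ≡ chain i j
chain-swap 0 0 = refl
chain-swap 0 1 = refl
chain-swap 0 2 = refl
chain-swap 0 (suc (suc (suc _))) = refl
chain-swap 1 0 = refl
chain-swap 1 1 = refl
chain-swap 1 2 = refl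
chain-swap 1 (suc (suc (suc _))) = refl
chain-swap (suc (suc _)) 0 = refl
chain-swap (suc (suc _)) 1 = refl
chain-swap (suc (suc _)) (suc (suc _)) = refl

swap-≤ : ∀ h i → i ≤ suc h * 2 → swap i ≤ suc h * 2
swap-≤ h 0 _ = s≤s z≤n
swap-≤ h 1 _ = z≤n
swap-≤ h (suc (suc i)) i≤ = i≤

swap-involutive : ∀ i → swap (swap i) ≡ i
swap-involutive 0 = refl
swap-involutive 1 = refl
swap-involutive (suc (suc i)) = refl

swapped : ∀ {X : Set} {_≟ˣ_ : DecidableEquality X} {h C φ} →
  TriangleChain _≟ˣ_ (suc h) C φ → TriangleChain _≟ˣ_ (suc h) C (φ ∘ swap)
swapped {h = h} {C} {φ} K = record
  { into     = λ i i≤ → into (swap i) (swap-≤ h i i≤)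
  ; onto     = onto′
  ; adjacent = λ i j i≤ j≤ →
      trans (adjacent (swap i) (swap j) (swap-≤ h i i≤) (swap-≤ h j j≤)) (chain-swap i j)
  }
  where
  open TriangleChain K
  onto′ : ∀ {v} → v ∈ V C → ∃[ i ] i ≤ suc h * 2 × φ (swap i) ≡ v
  onto′ v∈ with onto v∈
  ... | i , i≤ , refl = swap i , swap-≤ h i i≤ , cong φ (swap-involutive i)

-- Forcing trees and strategies.

module Strategies {X : Set} (_≟ˣ_ : DecidableEquality X) (G : Graph X) (A : Pred X 0ℓ) where

  open Transformation _≟ˣ_ using (gcds₂)
  open GCDS _≟ˣ_ G A

  -- A well-founded strategy tree for `P` that looks only at the current graph; the third index is
  -- the player to move. As `act` supplies an edge, play can end only at a `respond` node, which
  -- therefore carries the goal.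
  data Forces (P : Player) (Goal : Graph X → Set) : Player → Graph X → Set where
    act     : ∀ {C} (e : Edge C) → Forces P Goal (opponent P) (gcds₂ C e) → Forces P Goal P C
    respond : ∀ {C} → (NoEdges C → Goal C) → (∀ e → Forces P Goal P (gcds₂ C e)) →
              Forces P Goal (opponent P) C

  -- The irrelevant hypothesis cannot produce a witness, so the vertex list is searched; the
  -- hypothesis only refutes an empty search.
  edge? : ∀ (C : Graph X) → .(¬ NoEdges C) → Edge C
  edge? C ne with any? (λ p → any? (λ q → adj C p q Bool.≟ true) (V C)) (V C)
  ... | yes found = let p , _ , found′ = find found ; q , _ , pq = find found′ in p , q , pq
  ... | no none = ⊥-elim-irr (ne noEdges)
    where
    noEdges : NoEdges C
    noEdges p q with adj C p q in pq
    ... | false = refl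
    ... | true  = ⊥-elim (none (lose (adj-in-V C p q pq)
                    (lose (adj-in-V C q p (trans (adj-sym C q p) pq)) pq)))

  edge-≟ : ∀ (C : Graph X) → DecidableEquality (Edge C)
  edge-≟ C (x , y , xy) (x′ , y′ , xy′) with x ≟ˣ x′ | y ≟ˣ y′
  ... | yes refl | yes refl =
    yes (cong (λ h → x , y , h) (Decidable⇒UIP.≡-irrelevant Bool._≟_ xy xy′))
  ... | no x≢    | _        = no λ { refl → x≢ refl }
  ... | yes _    | no y≢    = no λ { refl → y≢ refl }

  module _ (w : Forces ONE FinalWinONE ONE G) where

    -- A strategy must also answer plays in which ONE has left the tree `w`; these have status
    -- `nothing`.
    Status : Player → Graph X → Set
    Status P C = Maybe (Forces ONE FinalWinONE P C)

    resume : ∀ {C} {e e′ : Edge C} → Forces ONE FinalWinONE TWO (gcds₂ C e) → Dec (e ≡ e′) →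
      Status TWO (gcds₂ C e′)
    resume s (yes refl) = just s
    resume s (no _)     = nothing

    resume-refl : ∀ {C} {e : Edge C} (s : Forces ONE FinalWinONE TWO (gcds₂ C e))
      (e≟e : Dec (e ≡ e)) →
      resume s e≟e ≡ just s
    resume-refl s (yes refl) = refl
    resume-refl s (no e≢e)   = ⊥-elim (e≢e refl)

    next : ∀ {P C} → Status P C → (e : Edge C) → Status (opponent P) (gcds₂ C e)
    next nothing              _  = nothing
    next (just (respond _ f)) e  = just (f e)
    next {C = C} (just (act e s)) e′ = resume s (edge-≟ C e e′)

    status : ∀ {P C} → Play P C → Status P C
    status start   = just w
    status (π ▷ e) = next (status π) e

    choose : ∀ {C} → Status ONE C → .(¬ NoEdges C) → Edge C
    -- An arbitrary edge: by `on-track`, no play that follows the strategy arrives here.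
    choose {C} nothing    ne = edge? C ne
    choose (just (act e _)) _ = e

    strategy : StrategyONE
    strategy π = choose (status π)

    on-track : ∀ {P C} {π : Play P C} → Follows strategy π → ∃[ s ] status π ≡ just s
    on-track start = w , refl
    on-track (byONE {C} {π} f ne) with status π | on-track f
    ... | _ | act e s , refl = s , resume-refl s (edge-≟ C e e)
    on-track (byTWO {π = π} f e) with status π | on-track f
    ... | _ | respond _ g , refl = g e , refl

    forced-win : ONEHasWinningStrategy
    forced-win = strategy , λ π f noEdges → win (proj₁ (on-track f)) noEdges
      where
      win : ∀ {P C} → Forces ONE FinalWinONE P C → NoEdges C → FinalWinONE C
      win (act (x , y , xy) _) noEdges with () ← trans (sym xy) (noEdges x y)
      win (respond final _)    noEdges = final noEdges

  -- TWO's tree is played against `σ`. Whenever ONE is to move an edge exists, since a finished game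
  -- would be both won and not won; so descending through the finite tree never stops, which is
  -- absurd.
  forced-loss : Forces TWO (¬_ ∘ FinalWinONE) ONE G → ¬ ONEHasWinningStrategy
  forced-loss w (σ , winning) = refute start w start
    where
    refute : ∀ {P C} (π : Play P C) → Forces TWO (¬_ ∘ FinalWinONE) P C → ¬ Follows σ π
    refute π (act e s) f = refute (π ▷ e) s (byTWO f e)
    refute {C = C} π (respond final g) f = refute (π ▷ σ π ne) (g (σ π ne)) (byONE f ne)
      where
      ne : ¬ NoEdges C
      ne noEdges = final noEdges (winning π f noEdges)

  -- Here `m` counts the rounds left, each removing two triangles; the invariant has to survive
  -- every thinning that `reply` may produce.
  forces : ∀ {P Goal c d} → Choice 0 c d → (Inv : ℕ → (ℕ → X) → Set) →
    (∀ m φ ψ → Inv (suc m) φ → Thinning c ψ → Inv m (φ ∘ ψ)) →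
    (∀ {C φ} → TriangleChain _≟ˣ_ 0 C φ → Inv 0 φ → Goal C) →
    ∀ m {C φ} → TriangleChain _≟ˣ_ (m * 2) C φ → Inv m φ → Forces P Goal (opponent P) C
  forces {P} {Goal} ch Inv thin final = go
    where
    open TriangleChain
    go : ∀ m {C φ} → TriangleChain _≟ˣ_ (m * 2) C φ → Inv m φ → Forces P Goal (opponent P) C
    go zero {C} {φ} K inv = respond (λ _ → final K inv) λ e → ⊥-elim (edgeless e)
      where
      edgeless : ¬ Edge C
      edgeless (x , y , xy)
        with onto K (adj-in-V C x y xy) | onto K (adj-in-V C y x (trans (adj-sym C y x) xy))
      ... | 0 , _ , refl | 0 , _ , refl with () ← trans (sym xy) (adj-irr C (φ 0))
    go (suc m) {C} {φ} K inv = respond (λ noEdges → ⊥-elim (edgy noEdges)) λ e →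
      let e′ , ψ , thinning , K′ = reply _≟ˣ_ ch K e
      in act e′ (go m K′ (thin m φ ψ inv thinning))
      where
      edgy : ¬ NoEdges C
      edgy noEdges with () ← trans (sym (adjacent K 0 1 z≤n (s≤s z≤n))) (noEdges (φ 0) (φ 1))

  -- A shift by four preserves the class of 3 modulo 4, and `tip` moves a good label from 3 to 0. A
  -- shift reads the good position with index `suc j`, so the range of `j` shrinks by one per round.
  ONE-forces : ∀ m {C φ} → TriangleChain _≟ˣ_ (m * 2) C φ →
    A (φ 0) × (∀ j → j < m → A (φ (3 + j * 4))) → Forces ONE FinalWinONE TWO C
  ONE-forces = forces tip (λ m φ → A (φ 0) × (∀ j → j < m → A (φ (3 + j * 4)))) thin final
    where
    thin : ∀ m (φ : ℕ → X) ψ → A (φ 0) × (∀ j → j < suc m → A (φ (3 + j * 4))) →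
      Thinning 3 ψ →
      A (φ (ψ 0)) × (∀ j → j < m → A (φ (ψ (3 + j * 4))))
    thin m φ ψ (A₀ , As) (ψ0 , ψs) =
      [ (λ eq → subst (A ∘ φ) (sym eq) A₀)
      , (λ eq → subst (A ∘ φ) (sym eq) (As 0 (s≤s z≤n))) ] ψ0 ,
      λ j j<m → [ (λ eq → subst (A ∘ φ) (sym eq) (As j (m<n⇒m<1+n j<m)))
                , (λ eq → subst (A ∘ φ) (sym eq) (As (suc j) (s≤s j<m))) ] (ψs (2 + j * 4))
    final : ∀ {C φ} → TriangleChain _≟ˣ_ 0 C φ → A (φ 0) × _ → FinalWinONE C
    final {C} {φ} K (A₀ , _) = (φ 0 , into 0 z≤n) , good
      where
      open TriangleChain K
      good : ∀ v → v ∈ V C → A v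
      good v v∈ with onto v∈
      ... | 0 , _ , refl = A₀

  -- With `spine` every displacement is by 0 or 4, so even positions only receive labels from even
  -- positions.
  TWO-forces : ∀ m {C φ} → TriangleChain _≟ˣ_ (m * 2) C φ → (∀ k → ¬ A (φ (k * 2))) →
    Forces TWO (¬_ ∘ FinalWinONE) ONE C
  TWO-forces = forces spine (λ _ φ → ∀ k → ¬ A (φ (k * 2))) thin final
    where
    thin : ∀ (_ : ℕ) (φ : ℕ → X) ψ → (∀ k → ¬ A (φ (k * 2))) → Thinning 4 ψ →
      ∀ k → ¬ A (φ (ψ (k * 2)))
    thin _ φ ψ bad (inj₁ eq , _) zero rewrite eq = bad 0
    thin _ φ ψ bad (inj₂ eq , _) zero rewrite eq = bad 2
    thin _ φ ψ bad (_ , ψs) (suc k) with ψs (suc (k * 2))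
    ... | inj₁ eq rewrite eq = bad (suc k)
    ... | inj₂ eq rewrite eq = bad (3 + k)
    final : ∀ {C φ} → TriangleChain _≟ˣ_ 0 C φ → (∀ k → ¬ A (φ (k * 2))) → ¬ FinalWinONE C
    final K bad ((v , v∈) , good) with TriangleChain.onto K v∈
    ... | 0 , _ , refl = bad 0 (good v v∈)

-- The sets `𝖠 n` and the conclusion.

odd∉𝖠 : ∀ n k → ¬ 𝖠 n (suc (k * 2))
odd∉𝖠 n zero    (inj₁ ())
odd∉𝖠 n (suc k) (inj₁ ())
odd∉𝖠 n k (inj₂ (_ , %4)) with m%n≡0⇒n∣m (suc (k * 2)) 4 %4
... | divides q eq = even≢odd (q * 2) k (trans (*-comm 2 (q * 2))
  (trans (*-assoc q 2 2) (trans (sym eq) (cong suc (*-comm k 2)))))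

-- These are the labels under `suc ∘ swap`: vertex 2 at position 0, and vertex 4+4j at position
-- 3+4j.
𝖠-swap : ∀ m → 𝖠 (suc (m * 2)) 2 × (∀ j → j < m → 𝖠 (suc (m * 2)) (4 + j * 4))
𝖠-swap m = inj₁ refl , λ j j<m → inj₂
  ( vertices-member (suc (m * 2)) (≤-trans (n≤1+n _) (≤-trans (*-monoˡ-≤ 4 j<m)
      (≤-trans (≤-reflexive (sym (*-assoc m 2 2))) (m≤n+m _ 2))))
  , m*n%n≡0 (suc j) 4)

corollary6 : (n : ℕ) .{{_ : NonZero n}} →
    GCDS.ONEHasWinningStrategy _≟_ (𝒢 n) (𝖠 n) ⇔ n % 2 ≡ 1
corollary6 n = mk⇔ odd wins
  where
  open Strategies _≟_ (𝒢 n) (𝖠 n)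

  chained : ∀ {h} → n ≡ h → TriangleChain _≟_ h (𝒢 n) suc
  chained refl = 𝒢-triangleChain n

  odd : GCDS.ONEHasWinningStrategy _≟_ (𝒢 n) (𝖠 n) → n % 2 ≡ 1
  odd w with n % 2 | m%n<n n 2 | m≡m%n+[m/n]*n n 2
  ... | 1 | _ | _  = refl
  ... | 0 | _ | eq = ⊥-elim (forced-loss
    (TWO-forces (n / 2) (chained eq) (odd∉𝖠 n)) w)
  ... | suc (suc _) | s≤s (s≤s ()) | _

  wins : n % 2 ≡ 1 → GCDS.ONEHasWinningStrategy _≟_ (𝒢 n) (𝖠 n)
  wins n%2 = forced-win (act (proj₁ first-move) (ONE-forces (n / 2) (proj₂ first-move)
      (subst (λ h → 𝖠 h 2 × (∀ j → j < n / 2 → 𝖠 h (4 + j * 4))) (sym eq) (𝖠-swap (n / 2)))))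
    where
    eq : n ≡ suc (n / 2 * 2)
    eq = trans (m≡m%n+[m/n]*n n 2) (cong (_+ n / 2 * 2) n%2)
    first-move : Σ[ e ∈ Edge (𝒢 n) ]
      TriangleChain _≟_ (n / 2 * 2) (Transformation.gcds₂ _≟_ (𝒢 n) e) (suc ∘ swap)
    -- The swap precedes the move because it needs a triangle: for `n = 1` the move leaves only
    -- position 0, which must already carry vertex 2.
    first-move = last-triangle _≟_ (swapped (chained eq))
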